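{- Let $G=(V,E)$ be a finite simple graph and let $e=\{u,v\}\in E$. If $e$ is an irrelevant edge of $G$, i.e. $D_t(G,x)=D_t(G\setminus e,x)$, then both $u$ and $v$ are total domination-covered in the graph $G\setminus e$.
   Context: For a finite simple graph $G=(V,E)$, a set $D\subseteq V$ is a total dominating set if every vertex of $V$ is adjacent to some vertex of $D$. $d_t(G,i)$ is the number of total dominating sets of $G$ of cardinality $i$, and $D_t(G,x)=\sum_i d_t(G,i)x^i$ is the total domination polynomial (equal to $0$ if $G$ has an isolated vertex). $G\setminus e$ denotes $G$ with the edge $e$ deleted (vertices kept); $G\setminus v$ denotes $G$ with the vertex $v$ deleted. An edge $e$ of $G$ is irrelevant if $D_t(G,x)=D_t(G\setminus e,x)$. A vertex $v$ of a graph $G$ is total domination-covered (in $G$) if each total dominating set of $G\setminus v$ is a total dominating set of $G$ and the total dominating sets of $G\setminus v$ are exactly those total dominating sets of $G$ that do not include $v$. -}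

module Defs where

open import Data.Fin using (Fin)
open import Data.Fin.Properties using (_≟_; all?; any?)
open import Data.Fin.Subset using (Subset; inside; outside; _∈_; _∉_; _⊆_; _-_; ∣_∣)
open import Data.Fin.Subset.Properties using (_∈?_; _⊆?_; x∈p∧x≢y⇒x∈p-y)
open import Data.List using (List; []; _∷_; _++_; map; filter; length; upTo)
open import Data.Nat using (ℕ; zero; suc)
import Data.Nat.Properties as ℕ
open import Data.Product using (_×_; _,_; ∃-syntax)
open import Data.Sum using (_⊎_; inj₁; inj₂)
open import Data.Vec using ([]; _∷_)
open import Function using (_⇔_)
open import Level using (0ℓ)
open import Relation.Binary using (Rel; Decidable; Symmetric; Irreflexive)
open import Relation.Binary.PropositionalEquality using (_≡_; _≢_)
open import Relation.Nullary using (¬_; Dec; ¬?; _×-dec_; _⊎-dec_; _→-dec_)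

-- A finite simple graph whose vertices are some of the labels in Fin n.
-- The vertex set V is a subset of the labels rather than all of Fin n so that
-- G and G ∖ᵛ v draw their vertices from the same labels, and sets of vertices
-- of the two graphs can be compared without relabelling.
record Graph (n : ℕ) : Set₁ where
  field
    V      : Subset n
    Adj    : Rel (Fin n) 0ℓ
    adj?   : Decidable Adj
    symm   : Symmetric Adj
    irrefl : Irreflexive _≡_ Adj
    inV    : ∀ {x y} → Adj x y → x ∈ V

open Graph

module _ {n : ℕ} where

  -- {x , y} = {u , v} as unordered pairs.
  SamePair : (u v x y : Fin n) → Set
  SamePair u v x y = (x ≡ u × y ≡ v) ⊎ (x ≡ v × y ≡ u)

  samePair? : ∀ u v x y → Dec (SamePair u v x y)
  samePair? u v x y = (x ≟ u ×-dec y ≟ v) ⊎-dec (x ≟ v ×-dec y ≟ u)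

  infixl 6 _∖ᵉ_ _∖ᵛ_

  _∖ᵉ_ : Graph n → Fin n × Fin n → Graph n
  G ∖ᵉ (u , v) = record
    { V      = V G
    ; Adj    = λ x y → Adj G x y × ¬ SamePair u v x y
    ; adj?   = λ x y → adj? G x y ×-dec ¬? (samePair? u v x y)
    ; symm   = λ { (xy , ne) → symm G xy , λ s → ne (swapPair s) }
    ; irrefl = λ { x≡y (xy , _) → irrefl G x≡y xy }
    ; inV    = λ { (xy , _) → inV G xy }
    }
    where
    swapPair : ∀ {x y} → SamePair u v y x → SamePair u v x y
    swapPair (inj₁ (p , q)) = inj₂ (q , p)
    swapPair (inj₂ (p , q)) = inj₁ (q , p)

  _∖ᵛ_ : Graph n → Fin n → Graph n
  G ∖ᵛ v = record
    { V      = V G - v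
    ; Adj    = λ x y → Adj G x y × x ≢ v × y ≢ v
    ; adj?   = λ x y → adj? G x y ×-dec ¬? (x ≟ v) ×-dec ¬? (y ≟ v)
    ; symm   = λ { (xy , x≢v , y≢v) → symm G xy , y≢v , x≢v }
    ; irrefl = λ { x≡y (xy , _) → irrefl G x≡y xy }
    ; inV    = λ { (xy , x≢v , _) → x∈p∧x≢y⇒x∈p-y (inV G xy) x≢v }
    }

  TotalDominating : Graph n → Subset n → Set
  TotalDominating G D =
    D ⊆ V G × (∀ x → x ∈ V G → ∃[ y ] (y ∈ D × Adj G x y))

  totalDominating? : ∀ G D → Dec (TotalDominating G D)
  totalDominating? G D =
    D ⊆? V G ×-dec
    all? (λ x → x ∈? V G →-dec any? (λ y → y ∈? D ×-dec adj? G x y))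

-- Every subset of Fin n, each listed exactly once.
subsets : ∀ n → List (Subset n)
subsets zero    = [] ∷ []
subsets (suc n) = map (outside ∷_) (subsets n) ++ map (inside ∷_) (subsets n)

-- A polynomial is its list of coefficients, constant term first; trailing
-- zeros are allowed, so equality of polynomials is _≈ₚ_ and not _≡_.
Polynomial : Set
Polynomial = List ℕ

coeff : Polynomial → ℕ → ℕ
coeff []      _       = 0
coeff (a ∷ _) zero    = a
coeff (_ ∷ p) (suc i) = coeff p i

infix 4 _≈ₚ_

_≈ₚ_ : Polynomial → Polynomial → Set
p ≈ₚ q = ∀ i → coeff p i ≡ coeff q i

module _ {n : ℕ} where

  dₜ : Graph n → ℕ → ℕ
  dₜ G i =
    length (filter (λ D → totalDominating? G D ×-dec ∣ D ∣ ℕ.≟ i) (subsets n))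

  -- The sum over i = 0 , … , ∣V∣ of dₜ G i · xⁱ.  A graph with an isolated
  -- vertex has no total dominating set, so its polynomial is 0 without a
  -- separate clause.
  Dₜ : Graph n → Polynomial
  Dₜ G = map (dₜ G) (upTo (suc ∣ V G ∣))

  Irrelevant : Graph n → Fin n × Fin n → Set
  Irrelevant G e = Dₜ G ≈ₚ Dₜ (G ∖ᵉ e)

  TotalDominationCovered : Graph n → Fin n → Set
  TotalDominationCovered G v =
    (∀ D → TotalDominating (G ∖ᵛ v) D → TotalDominating G D) ×
    (∀ D → TotalDominating (G ∖ᵛ v) D ⇔ (TotalDominating G D × v ∉ D))

{-# OPTIONS --safe #-}
module Submission where

-- A total dominating set of G ∖ e is one of G, so equal polynomials make the
-- total dominating sets of G and of G ∖ e the same sets.  If D dominates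
-- (G ∖ e) ∖ v, then D ∪ {u} dominates G, because e takes care of v; hence
-- D ∪ {u} dominates G ∖ e.  There v has a neighbour in D ∪ {u}, which is not u
-- because e is gone, and so lies in D.

open import Defs
open import Data.Nat using (ℕ; zero; suc; _<_; s≤s)
import Data.Nat.Properties as ℕ
open import Data.Fin using (Fin; zero; suc)
open import Data.Fin.Properties using (_≟_)
open import Data.Fin.Subset using (Subset; inside; outside; _∈_; _∉_; _-_; _∪_; ⁅_⁆; ∣_∣)
open import Data.Fin.Subset.Properties
  using (x∈⁅x⁆; x∈⁅y⁆⇒x≡y; p⊆q⇒∣p∣≤∣q∣; p⊆p∪q; q⊆p∪q; x∈p∪q⁻; p─q⊆p; x∈p∧x≢y⇒x∈p-y)
open import Data.List using (List; length; filter; applyUpTo)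
open import Data.List.Properties using (map-upTo)
import Data.List.Membership.Propositional as List
open import Data.List.Membership.Propositional.Properties
  using (∈-map⁺; ∈-++⁺ˡ; ∈-++⁺ʳ; ∈-filter⁺; ∈-filter⁻)
import Data.List.Relation.Unary.Any as Any
open import Data.List.Relation.Binary.Pointwise using (Pointwise-≡⇒≡)
open import Data.List.Relation.Binary.Sublist.Propositional using (⊆-refl)
open import Data.List.Relation.Binary.Sublist.Heterogeneous.Properties
  using (toPointwise; ⊆-filter-Sublist)
open import Data.Product using (_×_; _,_; proj₁; proj₂; map₁; ∃-syntax)
open import Data.Sum using (inj₁; inj₂)
open import Data.Vec using ([]; _∷_; there)
open import Function using (mk⇔)
open import Relation.Binary.PropositionalEquality
  using (_≡_; _≢_; refl; sym; subst; cong; module ≡-Reasoning)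
open import Relation.Nullary using (Dec; yes; no; contradiction; _×-dec_)
open import Relation.Unary using (Pred; Decidable)

open Graph

x∉p-x : ∀ {n} (p : Subset n) (x : Fin n) → x ∉ p - x
x∉p-x (_ ∷ p) zero    ()
x∉p-x (_ ∷ p) (suc x) (there x∈) = x∉p-x p x x∈

∈-subsets : ∀ {n} (D : Subset n) → D List.∈ subsets n
∈-subsets []            = Any.here refl
∈-subsets (outside ∷ D) = ∈-++⁺ˡ (∈-map⁺ (outside ∷_) (∈-subsets D))
∈-subsets (inside  ∷ D) = ∈-++⁺ʳ _ (∈-map⁺ (inside ∷_) (∈-subsets D))

coeff-applyUpTo : ∀ f {m i} → i < m → coeff (applyUpTo f m) i ≡ f i
coeff-applyUpTo f {suc m} {zero}  _         = refl
coeff-applyUpTo f {suc m} {suc i} (s≤s i<m) = coeff-applyUpTo (λ j → f (suc j)) i<m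

-- Since `P` implies `Q`, the list kept by `P?` is a sublist of the list kept by `Q?`, and a sublist
-- of full length is the whole list.
filter-⊆∧length≡⇒⊇ :
  ∀ {a p q} {A : Set a} {P : Pred A p} {Q : Pred A q}
  (P? : Decidable P) (Q? : Decidable Q) (xs : List A) → (∀ {x} → P x → Q x) →
  length (filter P? xs) ≡ length (filter Q? xs) →
  ∀ {x} → x List.∈ xs → Q x → P x
filter-⊆∧length≡⇒⊇ P? Q? xs P⊆Q eq x∈xs qx =
  proj₂ (∈-filter⁻ P? {xs = xs} (subst (_ List.∈_) (sym filters≡) (∈-filter⁺ Q? x∈xs qx)))
  where
  filters≡ : filter P? xs ≡ filter Q? xs
  filters≡ = Pointwise-≡⇒≡
    (toPointwise eq (⊆-filter-Sublist P? Q? (λ { refl → P⊆Q }) (⊆-refl {x = xs})))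

module _ {n : ℕ} where

  -- The bound keeps `i` inside the list of coefficients; past its end `coeff` falls back to 0.
  coeff-Dₜ : ∀ (G : Graph n) {i} → i < suc ∣ V G ∣ → coeff (Dₜ G) i ≡ dₜ G i
  coeff-Dₜ G {i} i< = begin
    coeff (Dₜ G) i                            ≡⟨ cong (λ p → coeff p i) (map-upTo (dₜ G) (suc ∣ V G ∣)) ⟩
    coeff (applyUpTo (dₜ G) (suc ∣ V G ∣)) i  ≡⟨ coeff-applyUpTo (dₜ G) i< ⟩
    dₜ G i                                    ∎
    where open ≡-Reasoning

  ∖ᵉ-totalDominating : ∀ (G : Graph n) e {D} → TotalDominating (G ∖ᵉ e) D → TotalDominating G D
  ∖ᵉ-totalDominating G e (D⊆V , dom) = D⊆V , λ x x∈V →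
    let y , y∈D , xy , _ = dom x x∈V in y , y∈D , xy

  ∖ᵛ-totalDominating : ∀ (G : Graph n) {v D} → TotalDominating G D → v ∉ D → TotalDominating (G ∖ᵛ v) D
  ∖ᵛ-totalDominating G {v} {D} (D⊆V , dom) v∉D =
    (λ y∈D → x∈p∧x≢y⇒x∈p-y (D⊆V y∈D) (≢v y∈D)) , λ x x∈V-v →
    let y , y∈D , xy = dom x (p─q⊆p (V G) ⁅ v ⁆ x∈V-v)
    in  y , y∈D , xy , (λ { refl → x∉p-x (V G) v x∈V-v }) , ≢v y∈D
    where
    ≢v : ∀ {y} → y ∈ D → y ≢ v
    ≢v y∈D refl = v∉D y∈D

  -- The other half of being covered is automatic: a dominating set of `G ∖ᵛ v` lies in `V G - v`,
  -- so it avoids `v`, and one of `G` that avoids `v` never uses an edge at `v` to dominate another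
  -- vertex.
  covered-if-dominated :
    ∀ (G : Graph n) {v} → (∀ D → TotalDominating (G ∖ᵛ v) D → TotalDominating G D) →
    TotalDominationCovered G v
  covered-if-dominated G {v} lift = lift , λ D →
    mk⇔ (λ td → lift D td , λ v∈D → x∉p-x (V G) v (proj₁ td v∈D))
        (λ { (td , v∉D) → ∖ᵛ-totalDominating G td v∉D })

  -- Compare the dominating sets of the size of `D` only: those of `G ∖ᵉ e` are among those of `G`,
  -- and the coefficients at that exponent say that there are equally many.
  irrelevant⇒totalDominating :
    ∀ (G : Graph n) e → Irrelevant G e → ∀ {D} → TotalDominating G D → TotalDominating (G ∖ᵉ e) D
  irrelevant⇒totalDominating G e irr {D} td = proj₁
    (filter-⊆∧length≡⇒⊇ (sized? (G ∖ᵉ e)) (sized? G) (subsets n)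
      (map₁ (∖ᵉ-totalDominating G e)) counts≡ (∈-subsets D) (td , refl))
    where
    -- The same decision as in `dₜ`, so that the lengths of the two filters are `dₜ` by definition.
    sized? : (H : Graph n) → Decidable (λ E → TotalDominating H E × ∣ E ∣ ≡ ∣ D ∣)
    sized? H E = totalDominating? H E ×-dec ∣ E ∣ ℕ.≟ ∣ D ∣

    -- As `D` lies in `V G`, its size is one of the listed exponents.
    ∣D∣< : ∣ D ∣ < suc ∣ V G ∣
    ∣D∣< = s≤s (p⊆q⇒∣p∣≤∣q∣ (proj₁ td))

    counts≡ : dₜ (G ∖ᵉ e) ∣ D ∣ ≡ dₜ G ∣ D ∣
    counts≡ = begin
      dₜ (G ∖ᵉ e) ∣ D ∣          ≡⟨ coeff-Dₜ (G ∖ᵉ e) ∣D∣< ⟨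
      coeff (Dₜ (G ∖ᵉ e)) ∣ D ∣  ≡⟨ irr ∣ D ∣ ⟨
      coeff (Dₜ G) ∣ D ∣         ≡⟨ coeff-Dₜ G ∣D∣< ⟩
      dₜ G ∣ D ∣                 ∎
      where open ≡-Reasoning

  -- Here `b` is the endpoint to be covered and `a` the other one; `SamePair` leaves open which of
  -- them is `u`, so one argument serves both.
  endpoint-covered :
    ∀ (G : Graph n) {u v a b} → Adj G b a → SamePair u v b a →
    Irrelevant G (u , v) → TotalDominationCovered (G ∖ᵉ (u , v)) b
  endpoint-covered G {u} {v} {a} {b} ba ba≡uv irr = covered-if-dominated G-e lift
    where
    G-e : Graph n
    G-e = G ∖ᵉ (u , v)

    lift : ∀ D → TotalDominating (G-e ∖ᵛ b) D → TotalDominating G-e D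
    lift D (D⊆V-b , dom) = D⊆V , dominated
      where
      D⊆V : ∀ {y} → y ∈ D → y ∈ V G
      D⊆V y∈D = p─q⊆p (V G) ⁅ b ⁆ (D⊆V-b y∈D)

      D∪a⊆V : ∀ {y} → y ∈ D ∪ ⁅ a ⁆ → y ∈ V G
      D∪a⊆V y∈ with x∈p∪q⁻ D ⁅ a ⁆ y∈
      ... | inj₁ y∈D = D⊆V y∈D
      ... | inj₂ y∈a rewrite x∈⁅y⁆⇒x≡y a y∈a = inV G (symm G ba)

      D∪a-dominating : TotalDominating G (D ∪ ⁅ a ⁆)
      D∪a-dominating = D∪a⊆V , λ x x∈V → neighbour x x∈V (x ≟ b)
        where
        neighbour : ∀ x → x ∈ V G → Dec (x ≡ b) → ∃[ y ] (y ∈ D ∪ ⁅ a ⁆ × Adj G x y)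
        -- The only place where the deleted edge is used: it joins `b` to the added vertex `a`.
        neighbour _ _   (yes refl) = a , q⊆p∪q D ⁅ a ⁆ (x∈⁅x⁆ a) , ba
        neighbour x x∈V (no x≢b)   =
          let y , y∈D , (xy , _) , _ = dom x (x∈p∧x≢y⇒x∈p-y x∈V x≢b)
          in  y , p⊆p∪q ⁅ a ⁆ y∈D , xy

      dominated : ∀ x → x ∈ V G → ∃[ y ] (y ∈ D × Adj G-e x y)
      dominated x x∈V with x ≟ b
      ... | no x≢b =
        let y , y∈D , xy , _ = dom x (x∈p∧x≢y⇒x∈p-y x∈V x≢b) in y , y∈D , xy
      ... | yes refl
        with y , y∈ , xy ← proj₂ (irrelevant⇒totalDominating G (u , v) irr D∪a-dominating) b x∈V
        with x∈p∪q⁻ D ⁅ a ⁆ y∈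
      ...   | inj₁ y∈D = y , y∈D , xy
      -- A neighbour equal to `a` would be reached along the deleted edge.
      ...   | inj₂ y∈a rewrite x∈⁅y⁆⇒x≡y a y∈a = contradiction ba≡uv (proj₂ xy)

theorem2p3 : ∀ (n : ℕ) (G : Graph n) (u v : Fin n) → Graph.Adj G u v → Irrelevant G (u , v) → TotalDominationCovered (G ∖ᵉ (u , v)) u × TotalDominationCovered (G ∖ᵉ (u , v)) v
theorem2p3 n G u v uv irr =
  endpoint-covered G uv (inj₁ (refl , refl)) irr ,
  endpoint-covered G (symm G uv) (inj₂ (refl , refl)) irr
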